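{- There exists a one-sided error non-adaptive tester for $k$-monotonicity of functions $f\colon\{0,1\}^d\to\{0,1\}$ with query complexity $q(d,\varepsilon,k)=2^{O(\sqrt d\cdot\log d\cdot\log(1/\varepsilon))}$.
   Context: The hypercube $\{0,1\}^d$ is ordered coordinatewise. A function $f\colon\{0,1\}^d\to\{0,1\}$ is $k$-monotone if there is no chain $x_1\preceq\cdots\preceq x_{k+1}$ with $f(x_1)=1$ and $f(x_i)\ne f(x_{i+1})$ for all $i\in[k]$. Distance is normalized Hamming distance $\Pr_x[f(x)\ne g(x)]$ under the uniform distribution; $f$ is $\varepsilon$-far from $k$-monotone if its distance to every $k$-monotone function is at least $\varepsilon$. A tester, given $\varepsilon$ and query access to $f$, accepts $k$-monotone $f$ with probability at least $2/3$ and rejects $f$ that is $\varepsilon$-far with probability at least $2/3$; one-sided means $k$-monotone functions are accepted with probability $1$; non-adaptive means the queries do not depend on previous answers. -}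

module Defs where

open import Data.Bool using (Bool; true; false; if_then_else_; not)
import Data.Bool as B
open import Data.Nat using (ℕ; zero; suc; _+_; _*_; _∸_; _^_; _≤_; _<_; _≤ᵇ_)
open import Data.Nat.DivMod using (_/_)
open import Data.Nat.Logarithm using (⌈log₂_⌉)
open import Data.Integer using (∣_∣)
open import Data.Rational using (ℚ; ↥_; ↧ₙ_)
open import Data.Fin using (Fin; inject₁) renaming (zero to fzero; suc to fsuc)
open import Data.Vec using (Vec; []; _∷_; lookup; map)
open import Data.Vec.Relation.Binary.Pointwise.Inductive using (Pointwise)
open import Data.List using (List; []; _∷_; _++_; allFin)
import Data.List as L
open import Data.Product using (Σ; _×_)
open import Relation.Nullary using (¬_)
open import Relation.Binary.PropositionalEquality using (_≡_; _≢_)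

Cube : ℕ → Set
Cube d = Vec Bool d

_⪯_ : ∀ {d} → Cube d → Cube d → Set
x ⪯ y = Pointwise B._≤_ x y

Violation : ∀ {d} (k : ℕ) → (Cube d → Bool) → Set
Violation {d} k f =
  Σ (Vec (Cube d) (suc k)) λ c →
    (f (lookup c fzero) ≡ true) ×
    ((i : Fin k) → (lookup c (inject₁ i) ⪯ lookup c (fsuc i))
                 × (f (lookup c (inject₁ i)) ≢ f (lookup c (fsuc i))))

KMonotone : ∀ {d} (k : ℕ) → (Cube d → Bool) → Set
KMonotone k f = ¬ Violation k f

allPoints : (d : ℕ) → List (Cube d)
allPoints zero = [] ∷ []
allPoints (suc d) = L.map (false ∷_) (allPoints d) ++ L.map (true ∷_) (allPoints d)

count : ∀ {A : Set} → (A → Bool) → List A → ℕ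
count p [] = 0
count p (x ∷ xs) = if p x then suc (count p xs) else count p xs

disagree : ∀ {d} → (Cube d → Bool) → (Cube d → Bool) → ℕ
disagree {d} f g = count (λ x → f x B.xor g x) (allPoints d)

-- ε-far from k-monotone (distance normalized by 2^d), for ε = ↥ε / ↧ε ≥ 0:
-- every k-monotone g satisfies  disagree f g / 2^d ≥ ε.
Far : ∀ {d} (ε : ℚ) (k : ℕ) → (Cube d → Bool) → Set
Far {d} ε k f = (g : Cube d → Bool) → KMonotone k g →
  ∣ ↥ ε ∣ * 2 ^ d ≤ disagree f g * ↧ₙ ε

-- A non-adaptive randomized tester with q queries on {0,1}^d.  Its randomness
-- is a uniformly random seed s ∈ Fin seeds (seeds ≥ 1); the query points
-- depend only on the seed (non-adaptive), and the verdict (true = accept) on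
-- the seed and the q answers.
record Tester (d q : ℕ) : Set where
  field
    seeds   : ℕ
    seeds>0 : 0 < seeds
    queries : Fin seeds → Vec (Cube d) q
    decide  : Fin seeds → Vec Bool q → Bool

  run : (Cube d → Bool) → Fin seeds → Bool
  run f s = decide s (map f (queries s))

  accepts : (Cube d → Bool) → ℕ
  accepts f = count (run f) (allFin seeds)

  rejects : (Cube d → Bool) → ℕ
  rejects f = count (λ s → not (run f s)) (allFin seeds)

OneSidedKMonTester : ∀ {d q} (k : ℕ) (ε : ℚ) → Tester d q → Set
OneSidedKMonTester {d} k ε T =
  ((f : Cube d → Bool) → KMonotone k f → accepts f ≡ seeds) ×
  ((f : Cube d → Bool) → Far ε k f → 2 * seeds ≤ 3 * rejects f)
  where open Tester T

-- ⌈√n⌉: least s with n ≤ s*s (searched from 0; fuel n+1 suffices).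
ceilSqrt : ℕ → ℕ
ceilSqrt n = go (suc n) 0
  where
  go : ℕ → ℕ → ℕ
  go zero s = s
  go (suc fuel) s = if n ≤ᵇ s * s then s else go fuel (suc s)

-- ⌈b / a⌉ for a > 0 (0 if a = 0); used for ⌈1/ε⌉ = ⌈↧ε / ↥ε⌉.
ceilDiv : ℕ → ℕ → ℕ
ceilDiv b zero = 0
ceilDiv b (suc a) = (b + a) / suc a

invCeil : ℚ → ℕ
invCeil ε = ceilDiv (↧ₙ ε) ∣ ↥ ε ∣

-- The exponent  √d · log d · log(1/ε)  up to constant factors, with the
-- usual "+1" so that it is positive for d = 1 or ε close to 1.
exponent : ℕ → ℚ → ℕ
exponent d ε = ceilSqrt d * suc ⌈log₂ d ⌉ * suc ⌈log₂ invCeil ε ⌉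

{-# OPTIONS --safe #-}

-- Let s = ⌈√d⌉, a = 2s + 2, b = 2s. The weight a^|x| b^(d - |x|) has mean
-- ((a + b)/2)^d, so by Markov's inequality it is large only for few points, and
-- likewise with a and b exchanged; call all other points middle points. For
-- y ⪯ x the product of the weight of x and the exchanged weight of y is
-- (ab)^d (a/b)^(|x| - |y|), so comparable middle points differ in at most
-- O(s log(1/ε)) coordinates.
--
-- Call x caught if a violation is visible among the points below x that differ
-- from x in at most that many coordinates. A violation among middle points makes
-- its own top point caught. Hence f restricted to the uncaught middle points is
-- k-monotone, and it extends to a k-monotone function on the cube: the parity of
-- the longest alternating chain below a point. If f is ε-far, the caught points
-- therefore have density at least ε/2 up to rounding of ε, and O(1/ε) random
-- points include a caught one with probability at least 2/3.
module Submission where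

open import Defs
open import Data.Bool using (Bool; true; false; if_then_else_; not; _∧_; _∨_; _xor_)
import Data.Bool as B
import Data.Bool.Properties as B
open import Data.Empty using (⊥; ⊥-elim)
open import Data.Fin using (Fin; inject₁) renaming (zero to fzero; suc to fsuc)
open import Data.Fin.Properties using (any?)
open import Data.Integer using (∣_∣)
import Data.Integer as ℤ
open import Data.List using (List; []; _∷_; _++_; allFin; length; cartesianProductWith)
import Data.List as L
import Data.List.Properties as L
open import Data.Nat
open import Data.Nat.DivMod using (m≡m%n+[m/n]*n; m%n<n)
open import Data.Nat.Induction using (<-rec)
open import Data.Nat.ListAction using (sum)
open import Data.Nat.ListAction.Properties using (sum-++)
open import Data.Nat.Logarithm using (⌈log₂_⌉; ⌈log₂⌈n/2⌉⌉≡⌈log₂n⌉∸1)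
open import Data.Nat.Properties
open import Data.Nat.Tactic.RingSolver using (solve-∀)
open import Data.Product using (Σ; ∃; _×_; _,_; proj₁; proj₂)
open import Data.Rational using (ℚ; 0ℚ; ↥_; ↧ₙ_)
import Data.Rational as ℚ
open import Data.Sum using (_⊎_; inj₁; inj₂)
open import Data.Unit using (⊤; tt)
open import Data.Vec using (Vec; []; _∷_; lookup; map; replicate; concat; tabulate; _[_]≔_)
open import Data.Vec.Membership.Propositional using (_∈_)
open import Data.Vec.Membership.Propositional.Properties using (∈-tabulate⁺; ∈-lookup)
open import Data.Vec.Properties as V using (lookup-map)
import Data.Vec.Relation.Unary.Any as Any
import Data.Vec.Relation.Unary.Any.Properties as Any
open import Data.Vec.Relation.Unary.Any using (here; there)
open import Data.Vec.Relation.Unary.Any.Properties using (lookup-index)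
import Data.Vec.Relation.Binary.Pointwise.Inductive as PW
open import Data.Vec.Relation.Binary.Pointwise.Inductive using ([]; _∷_)
open import Function using (_∘_; id)
open import Relation.Binary.PropositionalEquality
open import Relation.Nullary using (¬_; Dec; yes; no; does; contradiction)
open import Relation.Nullary.Decidable using (_×-dec_; ¬?; map′)

-- Elementary inequalities for powers, logarithms and roots

-- Bernoulli's inequality for 1 + u/v, multiplied by `v ^ (m + 1)` to stay within the naturals.
bernoulli : ∀ m v u → v ^ m * (v + m * u) ≤ v * (v + u) ^ m
bernoulli zero v u = ≤-reflexive (eq v)
  where
  eq : ∀ v → 1 * (v + 0) ≡ v * 1
  eq = solve-∀
bernoulli (suc m) v u = begin
  v * v ^ m * (v + (u + m * u))                   ≤⟨ m≤m+n _ (v ^ m * (m * u * u)) ⟩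
  v * v ^ m * (v + (u + m * u)) + v ^ m * (m * u * u) ≡⟨ eq₁ v u (v ^ m) m ⟩
  (v + u) * (v ^ m * (v + m * u))                 ≤⟨ *-monoʳ-≤ (v + u) (bernoulli m v u) ⟩
  (v + u) * (v * (v + u) ^ m)                     ≡⟨ eq₂ v (v + u) ((v + u) ^ m) ⟩
  v * ((v + u) * (v + u) ^ m)                     ∎
  where
  open ≤-Reasoning
  eq₁ : ∀ v u p m → v * p * (v + (u + m * u)) + p * (m * u * u) ≡ (v + u) * (p * (v + m * u))
  eq₁ = solve-∀
  eq₂ : ∀ v t p → t * (v * p) ≡ v * (t * p)
  eq₂ = solve-∀

-- This is (1 + 1/p)^i (1 - i/p) ≤ 1 without denominators. Each inductive step trades one factor
-- `suc p` for `p`, using (p + 1) r ≤ p (r + 1) for r ≤ p.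
reverse-bernoulli : ∀ p i r → i + r ≡ p → suc p ^ i * r ≤ p ^ i * p
reverse-bernoulli p zero r refl = ≤-refl
reverse-bernoulli p (suc i) r e = begin
  suc p * X * r         ≡⟨ eq₁ p X r ⟩
  X * (r + p * r)       ≤⟨ *-monoʳ-≤ X (+-monoˡ-≤ (p * r) (≤-trans (m≤n+m r (suc i)) (≤-reflexive e))) ⟩
  X * (p + p * r)       ≡⟨ eq₂ p X r ⟩
  p * (X * suc r)       ≤⟨ *-monoʳ-≤ p (reverse-bernoulli p i (suc r) (trans (+-suc i r) e)) ⟩
  p * (p ^ i * p)       ≡⟨ *-assoc p (p ^ i) p ⟨
  p * p ^ i * p         ∎
  where
  open ≤-Reasoning
  X = suc p ^ i
  eq₁ : ∀ p X r → suc p * X * r ≡ X * (r + p * r)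
  eq₁ = solve-∀
  eq₂ : ∀ p X r → X * (p + p * r) ≡ p * (X * suc r)
  eq₂ = solve-∀

suc-^-≤-double : ∀ p d .{{_ : NonZero p}} → 2 * d ≤ p → suc p ^ d ≤ 2 * p ^ d
suc-^-≤-double p d 2d≤p = *-cancelʳ-≤ _ _ p (begin
  suc p ^ d * p          ≤⟨ *-monoʳ-≤ (suc p ^ d) p≤2r ⟩
  suc p ^ d * (2 * r)    ≡⟨ eq (suc p ^ d) r ⟩
  2 * (suc p ^ d * r)    ≤⟨ *-monoʳ-≤ 2 (reverse-bernoulli p d r d+r≡p) ⟩
  2 * (p ^ d * p)        ≡⟨ *-assoc 2 (p ^ d) p ⟨
  2 * p ^ d * p          ∎)
  where
  open ≤-Reasoning
  r = p ∸ d
  d+r≡p : d + r ≡ p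
  d+r≡p = m+[n∸m]≡n (≤-trans (m≤n*m d 2) 2d≤p)
  d≤r : d ≤ r
  d≤r = +-cancelˡ-≤ d d r (begin
    d + d        ≡⟨ cong (d +_) (+-identityʳ d) ⟨
    2 * d        ≤⟨ 2d≤p ⟩
    p            ≡⟨ d+r≡p ⟨
    d + r        ∎)
  p≤2r : p ≤ 2 * r
  p≤2r = begin
    p            ≡⟨ d+r≡p ⟨
    d + r        ≤⟨ +-monoˡ-≤ r d≤r ⟩
    r + r        ≡⟨ cong (r +_) (+-identityʳ r) ⟨
    2 * r        ∎
  eq : ∀ X r → X * (2 * r) ≡ 2 * (X * r)
  eq = solve-∀

-- Amplification: if u of v + u points are good and their density is at least 2/m, then m
-- independent draws all miss them with probability at most 1/3, since (1 + u/v)^m ≥ 1 + m u/v ≥ 3.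
triple-^-≤ : ∀ m .{{_ : NonZero m}} v u → 2 * (v + u) ≤ m * u → 3 * v ^ m ≤ (v + u) ^ m
triple-^-≤ (suc m) zero u _ = z≤n
triple-^-≤ m v@(suc _) u h = *-cancelˡ-≤ v (begin
  v * (3 * v ^ m)              ≡⟨ eq v (v ^ m) ⟩
  v ^ m * (v + 2 * v)          ≤⟨ *-monoʳ-≤ (v ^ m) (+-monoʳ-≤ v (≤-trans (*-monoʳ-≤ 2 (m≤m+n v u)) h)) ⟩
  v ^ m * (v + m * u)          ≤⟨ bernoulli m v u ⟩
  v * (v + u) ^ m              ∎)
  where
  open ≤-Reasoning
  eq : ∀ v X → v * (3 * X) ≡ X * (v + 2 * v)
  eq = solve-∀

^-distribʳ-* : ∀ m n o → (n * o) ^ m ≡ n ^ m * o ^ m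
^-distribʳ-* zero n o = refl
^-distribʳ-* (suc m) n o = trans (cong (n * o *_) (^-distribʳ-* m n o)) (eq n o (n ^ m) (o ^ m))
  where
  eq : ∀ n o x y → n * o * (x * y) ≡ n * x * (o * y)
  eq = solve-∀

n≤2^⌈log₂n⌉ : ∀ n → n ≤ 2 ^ ⌈log₂ n ⌉
n≤2^⌈log₂n⌉ = <-rec _ step
  where
  open ≤-Reasoning
  step : ∀ n → (∀ {m} → m < n → m ≤ 2 ^ ⌈log₂ m ⌉) → n ≤ 2 ^ ⌈log₂ n ⌉
  step zero _ = z≤n
  step (suc zero) _ = s≤s z≤n
  step n@(suc (suc n′)) ih = begin
    n                          ≡⟨ ⌊n/2⌋+⌈n/2⌉≡n n ⟨
    ⌊ n /2⌋ + ⌈ n /2⌉          ≤⟨ +-monoˡ-≤ ⌈ n /2⌉ (⌊n/2⌋≤⌈n/2⌉ n) ⟩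
    ⌈ n /2⌉ + ⌈ n /2⌉          ≡⟨ cong (⌈ n /2⌉ +_) (+-identityʳ _) ⟨
    2 * ⌈ n /2⌉                ≤⟨ *-monoʳ-≤ 2 (ih (⌈n/2⌉<n n′)) ⟩
    2 * 2 ^ ⌈log₂ ⌈ n /2⌉ ⌉    ≡⟨ cong (λ e → 2 * 2 ^ e) (⌈log₂⌈n/2⌉⌉≡⌈log₂n⌉∸1 n) ⟩
    2 ^ ⌈log₂ n ⌉              ∎

≤-ceilDiv-* : ∀ b a .{{_ : NonZero a}} → b ≤ ceilDiv b a * a
≤-ceilDiv-* b (suc a) = +-cancelʳ-≤ a b _ (begin
  b + a                                        ≡⟨ m≡m%n+[m/n]*n (b + a) (suc a) ⟩
  (b + a) % suc a + ceilDiv b (suc a) * suc a  ≤⟨ +-monoˡ-≤ _ (≤-pred (m%n<n (b + a) (suc a))) ⟩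
  a + ceilDiv b (suc a) * suc a                ≡⟨ +-comm a _ ⟩
  ceilDiv b (suc a) * suc a + a                ∎)
  where open ≤-Reasoning

-- The search loop of ceilSqrt is a where-function without an accessible name.
-- Abstracting `suc n` and `2` in the second unfolding of ceilSqrt leaves it
-- applied to distinct variables, so that unification can solve sqrtFrom to it.
mutual
  sqrtFrom : ℕ → ℕ → ℕ → ℕ
  sqrtFrom = _

  ceilSqrt-unfold : ∀ n → ceilSqrt (suc n) ≡
    (if suc n ≤ᵇ 0 then 0 else if suc n ≤ᵇ 1 then 1 else sqrtFrom (suc n) n 2)
  ceilSqrt-unfold n with suc n | 2
  ... | _ | _ = refl

-- The sum `fuel + s` is invariant during the search, so the hypothesis covers the value returned
-- when the fuel runs out.
sqrtFrom-≥ : ∀ n fuel s → n ≤ (fuel + s) * (fuel + s) →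
             n ≤ sqrtFrom n fuel s * sqrtFrom n fuel s
sqrtFrom-≥ n zero s p = p
sqrtFrom-≥ n (suc fuel) s p with n ≤ᵇ s * s in eq
... | true  = ≤ᵇ⇒≤ n (s * s) (subst B.T (sym eq) tt)
... | false = sqrtFrom-≥ n fuel (suc s) (subst (λ t → n ≤ t * t) (sym (+-suc fuel s)) p)

≤-ceilSqrt² : ∀ n → n ≤ ceilSqrt n * ceilSqrt n
≤-ceilSqrt² n = sqrtFrom-≥ n (suc n) 0 (≤-trans (n≤1+n n)
  (subst (λ t → suc n ≤ t * t) (sym (+-identityʳ (suc n))) (m≤m*n (suc n) (suc n))))

does-false : ∀ {A : Set} (a? : Dec A) → does a? ≡ false → ¬ A
does-false (no ¬a) _ = ¬a

-- Counting

private
  variable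
    A A′ : Set
    d n : ℕ

count-++ : ∀ (p : A → Bool) xs ys → count p (xs ++ ys) ≡ count p xs + count p ys
count-++ p [] ys = refl
count-++ p (x ∷ xs) ys with p x
... | true  = cong suc (count-++ p xs ys)
... | false = count-++ p xs ys

count-map : ∀ (p : A′ → Bool) (h : A → A′) xs → count p (L.map h xs) ≡ count (p ∘ h) xs
count-map p h [] = refl
count-map p h (x ∷ xs) with p (h x)
... | true  = cong suc (count-map p h xs)
... | false = count-map p h xs

count-false : ∀ (xs : List A) → count (λ _ → false) xs ≡ 0
count-false [] = refl
count-false (_ ∷ xs) = count-false xs

count-true : ∀ (p : A → Bool) xs → (∀ x → p x ≡ true) → count p xs ≡ length xs
count-true p [] h = refl
count-true p (x ∷ xs) h rewrite h x = cong suc (count-true p xs h)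

count-not : ∀ (p : A → Bool) xs → count p xs + count (not ∘ p) xs ≡ length xs
count-not p [] = refl
count-not p (x ∷ xs) with p x
... | true  = cong suc (count-not p xs)
... | false = trans (+-suc _ _) (cong suc (count-not p xs))

count-mono : ∀ (p q : A → Bool) → (∀ x → p x ≡ true → q x ≡ true) →
             ∀ xs → count p xs ≤ count q xs
count-mono p q h [] = z≤n
count-mono p q h (x ∷ xs) with p x | q x | h x
... | true  | true  | _  = s≤s (count-mono p q h xs)
... | true  | false | h′ with () ← h′ refl
... | false | true  | _  = m≤n⇒m≤1+n (count-mono p q h xs)
... | false | false | _  = count-mono p q h xs

count-∨ : ∀ (p q : A → Bool) xs → count (λ x → p x ∨ q x) xs ≤ count p xs + count q xs
count-∨ p q [] = z≤n
count-∨ p q (x ∷ xs) with p x | q x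
... | true  | true  = s≤s (≤-trans (count-∨ p q xs) (+-monoʳ-≤ _ (n≤1+n _)))
... | true  | false = s≤s (count-∨ p q xs)
... | false | true  = ≤-trans (s≤s (count-∨ p q xs)) (≤-reflexive (sym (+-suc _ _)))
... | false | false = count-∨ p q xs

markov : ∀ K (W : A → ℕ) xs → count (λ x → K ≤ᵇ W x) xs * K ≤ sum (L.map W xs)
markov K W [] = z≤n
markov K W (x ∷ xs) with K ≤ᵇ W x in eq
... | true  = +-mono-≤ (≤ᵇ⇒≤ K (W x) (subst B.T (sym eq) tt)) (markov K W xs)
... | false = ≤-trans (markov K W xs) (m≤n+m _ (W x))

count-lookup : ∀ (p : A → Bool) xs → count (p ∘ L.lookup xs) (allFin (length xs)) ≡ count p xs
count-lookup p xs = begin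
  count (p ∘ L.lookup xs) (allFin (length xs))        ≡⟨ count-map p (L.lookup xs) (allFin (length xs)) ⟨
  count p (L.map (L.lookup xs) (allFin (length xs)))  ≡⟨ cong (count p) (L.map-tabulate id (L.lookup xs)) ⟩
  count p (L.tabulate (L.lookup xs))                  ≡⟨ cong (count p) (L.tabulate-lookup xs) ⟩
  count p xs                                          ∎
  where open ≡-Reasoning

length-allPoints : ∀ d → length (allPoints d) ≡ 2 ^ d
length-allPoints zero = refl
length-allPoints (suc d) = begin
  length (L.map (false ∷_) (allPoints d) ++ L.map (true ∷_) (allPoints d))
    ≡⟨ L.length-++ (L.map (false ∷_) (allPoints d)) ⟩
  length (L.map (false ∷_) (allPoints d)) + length (L.map (true ∷_) (allPoints d))
    ≡⟨ cong₂ _+_ (L.length-map _ (allPoints d)) (L.length-map _ (allPoints d)) ⟩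
  length (allPoints d) + length (allPoints d)
    ≡⟨ cong₂ _+_ (length-allPoints d) (trans (length-allPoints d) (sym (+-identityʳ _))) ⟩
  2 ^ suc d ∎
  where open ≡-Reasoning

-- A uniform position in this list amounts to m independent uniform draws from `xs`, with
-- replacement.
tuples : ∀ m → List A → List (Vec A m)
tuples zero xs = [] ∷ []
tuples (suc m) xs = cartesianProductWith _∷_ xs (tuples m xs)

allᵛ : (A → Bool) → Vec A n → Bool
allᵛ p [] = true
allᵛ p (x ∷ v) = p x ∧ allᵛ p v

allᵛ-lookup : ∀ (p : A → Bool) (v : Vec A n) → (∀ i → p (lookup v i) ≡ true) → allᵛ p v ≡ true
allᵛ-lookup p [] h = refl
allᵛ-lookup p (x ∷ v) h rewrite h fzero = allᵛ-lookup p v (h ∘ fsuc)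

count-tuples : ∀ m (p : A → Bool) xs → count (allᵛ p) (tuples m xs) ≡ count p xs ^ m
count-tuples zero p xs = refl
count-tuples {A} (suc m) p xs = trans (prod xs) (cong (count p xs *_) (count-tuples m p xs))
  where
  open ≡-Reasoning
  slice : ∀ b ts → count (λ t → b ∧ allᵛ p t) ts ≡ (if b then count (allᵛ p) ts else 0)
  slice true ts = refl
  slice false ts = count-false ts
  prod : ∀ ys → count (allᵛ p) (cartesianProductWith _∷_ ys (tuples m xs))
              ≡ count p ys * count (allᵛ p) (tuples m xs)
  prod [] = refl
  prod (y ∷ ys) = begin
    count (allᵛ p) (L.map (y ∷_) (tuples m xs) ++ cartesianProductWith _∷_ ys (tuples m xs))
      ≡⟨ count-++ (allᵛ p) (L.map (y ∷_) (tuples m xs)) _ ⟩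
    count (allᵛ p) (L.map (y ∷_) (tuples m xs)) + count (allᵛ p) (cartesianProductWith _∷_ ys (tuples m xs))
      ≡⟨ cong₂ _+_ (trans (count-map (allᵛ p) (y ∷_) (tuples m xs)) (slice (p y) (tuples m xs))) (prod ys) ⟩
    (if p y then count (allᵛ p) (tuples m xs) else 0) + count p ys * count (allᵛ p) (tuples m xs)
      ≡⟨ add (p y) ⟩
    (if p y then suc (count p ys) else count p ys) * count (allᵛ p) (tuples m xs) ∎
    where
    add : ∀ b → (if b then count (allᵛ p) (tuples m xs) else 0) + count p ys * count (allᵛ p) (tuples m xs)
              ≡ (if b then suc (count p ys) else count p ys) * count (allᵛ p) (tuples m xs)
    add true = refl
    add false = refl

length-tuples : ∀ m (xs : List A) → length (tuples m xs) ≡ length xs ^ m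
length-tuples m xs = begin
  length (tuples m xs)                      ≡⟨ count-true _ (tuples m xs) (λ v → allᵛ-lookup _ v (λ _ → refl)) ⟨
  count (allᵛ (λ _ → true)) (tuples m xs)   ≡⟨ count-tuples m _ xs ⟩
  count (λ _ → true) xs ^ m                 ≡⟨ cong (_^ m) (count-true _ xs (λ _ → refl)) ⟩
  length xs ^ m                             ∎
  where open ≡-Reasoning

-- Weights of points and Markov's inequality

weight : ℕ → ℕ → Cube d → ℕ
weight a b [] = 1
weight a b (x ∷ xs) = (if x then a else b) * weight a b xs

sum-*ˡ : ∀ c (W : A → ℕ) xs → sum (L.map (λ x → c * W x) xs) ≡ c * sum (L.map W xs)
sum-*ˡ c W [] = sym (*-zeroʳ c)
sum-*ˡ c W (x ∷ xs) = trans (cong (c * W x +_) (sum-*ˡ c W xs)) (sym (*-distribˡ-+ c (W x) _))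

sum-weight : ∀ d a b → sum (L.map (weight a b) (allPoints d)) ≡ (a + b) ^ d
sum-weight zero a b = refl
sum-weight (suc d) a b = begin
  sum (L.map W (L.map (false ∷_) pts ++ L.map (true ∷_) pts))
    ≡⟨ cong sum (L.map-++ W (L.map (false ∷_) pts) _) ⟩
  sum (L.map W (L.map (false ∷_) pts) ++ L.map W (L.map (true ∷_) pts))
    ≡⟨ sum-++ (L.map W (L.map (false ∷_) pts)) _ ⟩
  sum (L.map W (L.map (false ∷_) pts)) + sum (L.map W (L.map (true ∷_) pts))
    ≡⟨ cong₂ _+_ (half false) (half true) ⟩
  b * (a + b) ^ d + a * (a + b) ^ d
    ≡⟨ *-distribʳ-+ ((a + b) ^ d) b a ⟨
  (b + a) * (a + b) ^ d
    ≡⟨ cong (_* (a + b) ^ d) (+-comm b a) ⟩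
  (a + b) ^ suc d ∎
  where
  open ≡-Reasoning
  W : Cube (suc d) → ℕ
  W = weight a b
  pts = allPoints d
  half : ∀ x → sum (L.map W (L.map (x ∷_) pts)) ≡ (if x then a else b) * (a + b) ^ d
  half x = begin
    sum (L.map W (L.map (x ∷_) pts))                         ≡⟨ cong sum (L.map-∘ pts) ⟨
    sum (L.map (λ y → (if x then a else b) * weight a b y) pts) ≡⟨ sum-*ˡ (if x then a else b) (weight a b) pts ⟩
    (if x then a else b) * sum (L.map (weight a b) pts)      ≡⟨ cong ((if x then a else b) *_) (sum-weight d a b) ⟩
    (if x then a else b) * (a + b) ^ d                       ∎

-- The weight is a product over coordinates, so its mean over the cube is `n ^ d`; Markov's
-- inequality at K times the mean leaves a fraction of at most 1/K.
count-heavy : ∀ d K n a b .{{_ : NonZero n}} → a + b ≡ 2 * n →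
              count (λ x → K * n ^ d ≤ᵇ weight a b x) (allPoints d) * K ≤ 2 ^ d
count-heavy d K n a b a+b≡2n = *-cancelʳ-≤ _ _ (n ^ d) {{m^n≢0 n d}} (begin
  c * K * n ^ d                             ≡⟨ *-assoc c K (n ^ d) ⟩
  c * (K * n ^ d)                           ≤⟨ markov (K * n ^ d) (weight a b) (allPoints d) ⟩
  sum (L.map (weight a b) (allPoints d))    ≡⟨ sum-weight d a b ⟩
  (a + b) ^ d                               ≡⟨ cong (_^ d) a+b≡2n ⟩
  (2 * n) ^ d                               ≡⟨ ^-distribʳ-* d 2 n ⟩
  2 ^ d * n ^ d                             ∎)
  where
  open ≤-Reasoning
  c = count (λ x → K * n ^ d ≤ᵇ weight a b x) (allPoints d)

-- Alternating chains

⪯-refl : {x : Cube d} → x ⪯ x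
⪯-refl = PW.refl B.≤-refl

⪯-trans : {x y z : Cube d} → x ⪯ y → y ⪯ z → x ⪯ z
⪯-trans = PW.trans B.≤-trans

⪯-top : (x : Cube d) → x ⪯ replicate d true
⪯-top [] = []
⪯-top (x ∷ xs) = B.≤-maximum x ∷ ⪯-top xs

any-cube? : {P : Cube d → Set} → (∀ x → Dec (P x)) → Dec (∃ P)
any-cube? {zero} P? = map′ ([] ,_) (λ { ([] , p) → p }) (P? [])
any-cube? {suc d} P? with any-cube? (P? ∘ (false ∷_)) | any-cube? (P? ∘ (true ∷_))
... | yes (x , p) | _           = yes (false ∷ x , p)
... | no _        | yes (x , p) = yes (true ∷ x , p)
... | no ¬p       | no ¬q       = no λ { (false ∷ x , p) → ¬p (x , p) ; (true ∷ x , p) → ¬q (x , p) }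

odd : ℕ → Bool
odd zero = false
odd (suc n) = not (odd n)

-- P y b records that the value of the function at y is known to be b.
-- Reach P j x: below x there is an alternating chain of j points with known
-- values whose smallest point has value 1.
Reach : (Cube d → Bool → Set) → ℕ → Cube d → Set
Reach P zero x = ⊤
Reach P (suc j) x = ∃ λ y → y ⪯ x × P y (odd (suc j)) × Reach P j y

reach? : {P : Cube d → Bool → Set} → (∀ y b → Dec (P y b)) → ∀ j x → Dec (Reach P j x)
reach? P? zero x = yes tt
reach? P? (suc j) x = any-cube? λ y →
  PW.decidable B._≤?_ y x ×-dec P? y (odd (suc j)) ×-dec reach? P? j y

reach-map : {P Q : Cube d → Bool → Set} {z : Cube d} →
            (∀ y b → y ⪯ z → P y b → Q y b) →
            ∀ j {x} → x ⪯ z → Reach P j x → Reach Q j x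
reach-map h zero x⪯z r = tt
reach-map h (suc j) x⪯z (y , y⪯x , p , r) =
  y , y⪯x , h y _ (⪯-trans y⪯x x⪯z) p , reach-map h j (⪯-trans y⪯x x⪯z) r

reach-mono : {P : Cube d → Bool → Set} {x y : Cube d} → x ⪯ y → ∀ j → Reach P j x → Reach P j y
reach-mono x⪯y zero r = tt
reach-mono x⪯y (suc j) (z , z⪯x , r) = z , ⪯-trans z⪯x x⪯y , r

Alternating : (Cube d → Bool) → Vec (Cube d) (suc n) → Set
Alternating {n = n} f c =
  (i : Fin n) → (lookup c (inject₁ i) ⪯ lookup c (fsuc i))
              × (f (lookup c (inject₁ i)) ≢ f (lookup c (fsuc i)))

-- `Reach` unfolds from the top of the chain, whereas `Violation` lists it from the bottom, so each
-- step down puts a point in front. The last one has value `odd 1`, the starting value 1 of a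
-- violation.
reach⇒violation : {f : Cube d → Bool} {P : Cube d → Bool → Set} → (∀ y b → P y b → f y ≡ b) →
                  ∀ k {x} → Reach P (suc k) x → Violation k f
reach⇒violation {f = f} {P} sound k (y , _ , p , r) =
  subst (λ l → Violation l f) (+-identityʳ k)
        (extend k (y ∷ []) (λ ()) (sound y _ p) r)
  where
  extend : ∀ j {n} (c : Vec (Cube _) (suc n)) → Alternating f c →
           f (lookup c fzero) ≡ odd (suc j) → Reach P j (lookup c fzero) → Violation (j + n) f
  extend zero c alt e r = c , e , alt
  extend (suc j) {n} c@(_ ∷ _) alt e (z , z⪯ , q , r) =
    subst (λ l → Violation l f) (+-suc j n) (extend j (z ∷ c) alt′ (sound z _ q) r)
    where
    alt′ : Alternating f (z ∷ c)
    alt′ fzero = z⪯ , λ eq → B.not-¬ (trans (sym eq) (sound z _ q)) e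
    alt′ (fsuc i) = alt i

-- A function whose values are known on D, where they show no violation,
-- extends by the parity of the longest alternating chain of D below a point.
module Extension (f : Cube d → Bool) (D : Cube d → Set) (D? : ∀ x → Dec (D x)) (k : ℕ)
                 (unreachable : ∀ x → ¬ Reach (λ y b → D y × f y ≡ b) (suc k) x) where

  Known : Cube d → Bool → Set
  Known y b = D y × f y ≡ b

  known? : ∀ y b → Dec (Known y b)
  known? y b = D? y ×-dec f y B.≟ b

  heightUpTo : ℕ → Cube d → ℕ
  heightUpTo zero x = 0
  heightUpTo (suc j) x with reach? known? (suc j) x
  ... | yes _ = suc j
  ... | no _  = heightUpTo j x

  reach-heightUpTo : ∀ j x → Reach Known (heightUpTo j x) x
  reach-heightUpTo zero x = tt
  reach-heightUpTo (suc j) x with reach? known? (suc j) x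
  ... | yes r = r
  ... | no _  = reach-heightUpTo j x

  heightUpTo-≤ : ∀ j x → heightUpTo j x ≤ j
  heightUpTo-≤ zero x = z≤n
  heightUpTo-≤ (suc j) x with reach? known? (suc j) x
  ... | yes _ = ≤-refl
  ... | no _  = m≤n⇒m≤1+n (heightUpTo-≤ j x)

  heightUpTo-max : ∀ j i x → i ≤ j → Reach Known i x → i ≤ heightUpTo j x
  heightUpTo-max zero i x i≤j r = i≤j
  heightUpTo-max (suc j) i x i≤j r with reach? known? (suc j) x
  ... | yes _ = i≤j
  ... | no ¬r with m≤n⇒m<n∨m≡n i≤j
  ...   | inj₁ i<1+j = heightUpTo-max j i x (≤-pred i<1+j) r
  ...   | inj₂ refl  = contradiction r ¬r

  -- Cutting off at k loses nothing, because `unreachable` rules out longer chains.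
  height : Cube d → ℕ
  height = heightUpTo k

  extension : Cube d → Bool
  extension x = odd (height x)

  height-mono : ∀ {x y} → x ⪯ y → height x ≤ height y
  height-mono {x} {y} x⪯y = heightUpTo-max k (height x) y (heightUpTo-≤ k x)
    (reach-mono x⪯y (height x) (reach-heightUpTo k x))

  -- Height never decreases upwards, and a change of its parity forces it to grow by at least 1 at
  -- every step.
  height-alternating : ∀ n (c : Vec (Cube d) (suc n)) → Alternating extension c →
                       height (lookup c fzero) + n ≤ k
  height-alternating zero (x ∷ []) alt = ≤-trans (≤-reflexive (+-identityʳ _)) (heightUpTo-≤ k x)
  height-alternating (suc n) (x ∷ c@(y ∷ _)) alt = begin
    height x + suc n     ≡⟨ +-suc (height x) n ⟩
    suc (height x) + n   ≤⟨ +-monoˡ-≤ n hx<hy ⟩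
    height y + n         ≤⟨ height-alternating n c (alt ∘ fsuc) ⟩
    k                    ∎
    where
    open ≤-Reasoning
    hx<hy : height x < height y
    hx<hy = ≤∧≢⇒< (height-mono (proj₁ (alt fzero))) (proj₂ (alt fzero) ∘ cong odd)

  extension-kMonotone : KMonotone k extension
  extension-kMonotone (c , start , alt) with height (lookup c fzero) | height-alternating k c alt
  -- A violation starts at value 1, hence at positive height, and k further increases would exceed
  -- k.
  ... | zero  | _ with () ← start
  ... | suc h | h+k<k = <⇒≱ h+k<k (m≤n+m k h)

  -- Otherwise x itself prolongs a longest chain below it by one point, against maximality or, at
  -- height k, against `unreachable`.
  extension-agrees : ∀ {x} → D x → f x ≡ extension x
  extension-agrees {x} Dx with f x B.≟ extension x
  ... | yes eq = eq
  ... | no neq = ⊥-elim (absurd (m≤n⇒m<n∨m≡n (heightUpTo-≤ k x)))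
    where
    higher : Reach Known (suc (height x)) x
    higher = x , ⪯-refl , (Dx , B.¬-not neq) , reach-heightUpTo k x
    absurd : height x < k ⊎ height x ≡ k → ⊥
    absurd (inj₁ h<k) = <-irrefl refl (heightUpTo-max k (suc (height x)) x h<k higher)
    absurd (inj₂ h≡k) = unreachable x (subst (λ h → Reach Known (suc h) x) h≡k higher)

-- Distance between comparable points

gap : {x y : Cube d} → x ⪯ y → ℕ
gap [] = 0
gap (B.f≤t ∷ p) = suc (gap p)
gap (B.b≤b ∷ p) = gap p

gap-step : {x y : Cube d} (p : x ⪯ y) →
           x ≡ y ⊎ ∃ λ i → Σ (x ⪯ (y [ i ]≔ false)) λ q → gap p ≡ suc (gap q)
gap-step [] = inj₁ refl
gap-step (B.f≤t ∷ p) = inj₂ (fzero , B.b≤b ∷ p , refl)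
gap-step (B.b≤b ∷ p) with gap-step p
... | inj₁ refl          = inj₁ refl
... | inj₂ (i , q , eq)  = inj₂ (fsuc i , B.b≤b ∷ q , eq)

-- A coordinate where x and y agree contributes ab to the product of weights; one where they differ
-- contributes a² = ab (a/b). The factor `b ^ gap p` clears the denominator.
weight-gap : ∀ a b {x y : Cube d} (p : x ⪯ y) →
             weight b a x * weight a b y * b ^ gap p ≡ (a * b) ^ d * a ^ gap p
weight-gap a b [] = refl
weight-gap {suc d} a b {_ ∷ x} {_ ∷ y} (B.f≤t ∷ p) = begin
  a * wx * (a * wy) * (b * β)       ≡⟨ eq₁ a b wx wy β ⟩
  a * b * (wx * wy * β) * a         ≡⟨ cong (λ t → a * b * t * a) (weight-gap a b p) ⟩
  a * b * ((a * b) ^ d * α) * a     ≡⟨ eq₂ a b ((a * b) ^ d) α ⟩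
  a * b * (a * b) ^ d * (a * α)     ∎
  where
  open ≡-Reasoning
  wx = weight b a x
  wy = weight a b y
  α = a ^ gap p
  β = b ^ gap p
  eq₁ : ∀ a b x y β → a * x * (a * y) * (b * β) ≡ a * b * (x * y * β) * a
  eq₁ = solve-∀
  eq₂ : ∀ a b P α → a * b * (P * α) * a ≡ a * b * P * (a * α)
  eq₂ = solve-∀
weight-gap {suc d} a b {z ∷ x} {_ ∷ y} (B.b≤b ∷ p) = begin
  cz * wx * (c′z * wy) * β          ≡⟨ eq₁ cz c′z wx wy β ⟩
  cz * c′z * (wx * wy * β)          ≡⟨ cong₂ _*_ (both z) (weight-gap a b p) ⟩
  a * b * ((a * b) ^ d * α)         ≡⟨ *-assoc (a * b) _ α ⟨
  a * b * (a * b) ^ d * α           ∎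
  where
  open ≡-Reasoning
  wx = weight b a x
  wy = weight a b y
  α = a ^ gap p
  β = b ^ gap p
  cz = if z then b else a
  c′z = if z then a else b
  both : ∀ z → (if z then b else a) * (if z then a else b) ≡ a * b
  both true = *-comm b a
  both false = refl
  eq₁ : ∀ c c′ x y β → c * x * (c′ * y) * β ≡ c * c′ * (x * y * β)
  eq₁ = solve-∀

-- The tester

∈-concat-map : (h : A → Vec A′ n) {m : ℕ} (xs : Vec A m) {x : A} {y : A′} →
               x ∈ xs → y ∈ h x → y ∈ concat (map h xs)
∈-concat-map h xs x∈xs y∈hx = Any.concat⁺ (Any.map⁺ (Any.map (λ { refl → y∈hx }) x∈xs))

-- Keeping x itself makes w rounds cover all descents of at most w steps. Repetitions are harmless
-- and keep the length independent of x.
lowered : Cube d → Vec (Cube d) (suc d)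
lowered x = x ∷ tabulate (λ i → x [ i ]≔ false)

descend : ∀ w → Cube d → Vec (Cube d) (suc d ^ w)
descend zero x = x ∷ []
descend (suc w) x = concat (map (descend w) (lowered x))

∈-descend-refl : ∀ w (x : Cube d) → x ∈ descend w x
∈-descend-refl zero x = here refl
∈-descend-refl (suc w) x = ∈-concat-map (descend w) (lowered x) (here refl) (∈-descend-refl w x)

∈-descend : ∀ w {x y : Cube d} (p : y ⪯ x) → gap p ≤ w → y ∈ descend w x
∈-descend w p g≤w with gap-step p
∈-descend w {x} p g≤w | inj₁ refl = ∈-descend-refl w x
∈-descend zero p g≤w | inj₂ (i , q , eq) with () ← subst (_≤ 0) eq g≤w
∈-descend (suc w) {x} p g≤w | inj₂ (i , q , eq) =
  ∈-concat-map (descend w) (lowered x) (there (∈-tabulate⁺ _ i))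
    (∈-descend w q (≤-pred (subst (_≤ suc w) eq g≤w)))

-- The tester queries the points obtained from each of m random points by
-- clearing at most w coordinates, and rejects when the answers show a violation.
module DescentTester (d k m w : ℕ) where

  q : ℕ
  q = m * suc d ^ w

  queryPoints : Vec (Cube d) m → Vec (Cube d) q
  queryPoints = concat ∘ map (descend w)

  -- The verdict may depend on f only through the answers, so known values are read off by position
  -- in the query vector.
  Answer : Vec (Cube d) q → Vec Bool q → Cube d → Bool → Set
  Answer ps as y b = ∃ λ i → lookup ps i ≡ y × lookup as i ≡ b

  answer? : ∀ ps as y b → Dec (Answer ps as y b)
  answer? ps as y b = any? λ i → V.≡-dec B._≟_ (lookup ps i) y ×-dec lookup as i B.≟ b

  -- Every point lies below this one, so reachability here searches all queried points, including
  -- chains across different samples.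
  top : Cube d
  top = replicate d true

  verdict : Vec (Cube d) m → Vec Bool q → Bool
  verdict v as = not (does (reach? (answer? (queryPoints v) as) (suc k) top))

  samples : List (Vec (Cube d) m)
  samples = tuples m (allPoints d)

  length-samples : length samples ≡ (2 ^ d) ^ m
  length-samples = trans (length-tuples m (allPoints d)) (cong (_^ m) (length-allPoints d))

  tester : Tester d q
  tester = record
    { seeds   = length samples
    ; seeds>0 = subst (0 <_) (sym length-samples) (m^n>0 (2 ^ d) {{m^n≢0 2 d}} m)
    ; queries = queryPoints ∘ L.lookup samples
    ; decide  = verdict ∘ L.lookup samples
    }

  open Tester tester using (seeds; accepts; rejects; run)

  module _ (f : Cube d → Bool) where

    answers : Vec (Cube d) m → Vec Bool q
    answers v = map f (queryPoints v)

    complete : KMonotone k f → accepts f ≡ seeds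
    complete mono = trans (count-true (run f) (allFin seeds) (accepted ∘ L.lookup samples))
                          (L.length-tabulate id)
      where
      accepted : ∀ v → verdict v (answers v) ≡ true
      accepted v with reach? (answer? (queryPoints v) (answers v)) (suc k) top
      ... | no _  = refl
      ... | yes r = ⊥-elim (mono (reach⇒violation sound k r))
        where
        sound : ∀ y b → Answer (queryPoints v) (answers v) y b → f y ≡ b
        sound y b (i , refl , e) = trans (sym (lookup-map i f (queryPoints v))) e

    Caught : Cube d → Set
    Caught x = Reach (λ y b → y ∈ descend w x × f y ≡ b) (suc k) x

    caught? : ∀ x → Dec (Caught x)
    caught? x = reach? (λ y b → Any.any? (V.≡-dec B._≟_ y) (descend w x) ×-dec f y B.≟ b) (suc k) x

    caught : Cube d → Bool
    caught x = does (caught? x)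

    -- The chain witnessing that a sample is caught consists of queried points, so the verdict would
    -- find it.
    accepted⇒uncaught : ∀ v → verdict v (answers v) ≡ true → allᵛ (not ∘ caught) v ≡ true
    accepted⇒uncaught v acc = allᵛ-lookup (not ∘ caught) v uncaught
      where
      uncaught : ∀ i → not (caught (lookup v i)) ≡ true
      uncaught i with caught? (lookup v i)
      ... | no _  = refl
      ... | yes r = contradiction
        (reach-mono (⪯-top _) (suc k) (reach-map shown (suc k) ⪯-refl r))
        (does-false (reach? _ (suc k) top) (B.not-injective acc))
        where
        shown : ∀ y b → y ⪯ lookup v i → y ∈ descend w (lookup v i) × f y ≡ b →
                Answer (queryPoints v) (answers v) y b
        shown y b _ (y∈ , fy≡b) = Any.index y∈′ , sym (lookup-index y∈′) ,
          trans (lookup-map _ f (queryPoints v)) (trans (cong f (sym (lookup-index y∈′))) fy≡b)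
          where
          y∈′ : y ∈ queryPoints v
          y∈′ = ∈-concat-map (descend w) v (∈-lookup i v) y∈

    caught+uncaught : count caught (allPoints d) + count (not ∘ caught) (allPoints d) ≡ 2 ^ d
    caught+uncaught = trans (count-not caught (allPoints d)) (length-allPoints d)

    -- Acceptance requires all m samples to be uncaught; the hypothesis bounds the probability of
    -- that by 1/3.
    sound : 3 * count (not ∘ caught) (allPoints d) ^ m ≤ (2 ^ d) ^ m →
            2 * seeds ≤ 3 * rejects f
    sound h = +-cancelˡ-≤ (3 * accepts f) _ _ (begin
      3 * accepts f + 2 * seeds          ≤⟨ +-monoˡ-≤ (2 * seeds) 3a≤s ⟩
      seeds + 2 * seeds                  ≡⟨⟩
      3 * seeds                          ≡⟨ cong (3 *_) split ⟨
      3 * (accepts f + rejects f)        ≡⟨ *-distribˡ-+ 3 (accepts f) (rejects f) ⟩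
      3 * accepts f + 3 * rejects f      ∎)
      where
      open ≤-Reasoning
      split : accepts f + rejects f ≡ seeds
      split = trans (count-not (run f) (allFin seeds)) (L.length-tabulate id)
      3a≤s : 3 * accepts f ≤ seeds
      3a≤s = begin
        3 * accepts f      ≡⟨ cong (3 *_) (count-lookup (λ v → verdict v (answers v)) samples) ⟩
        3 * count (λ v → verdict v (answers v)) samples
          ≤⟨ *-monoʳ-≤ 3 (count-mono _ (allᵛ (not ∘ caught)) accepted⇒uncaught samples) ⟩
        3 * count (allᵛ (not ∘ caught)) samples
          ≡⟨ cong (3 *_) (count-tuples m (not ∘ caught) (allPoints d)) ⟩
        3 * count (not ∘ caught) (allPoints d) ^ m
          ≤⟨ h ⟩
        (2 ^ d) ^ m        ≡⟨ length-samples ⟨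
        seeds              ∎

    -- A violation among uncaught points outside `outer` lies within distance w
    -- below its own top point, which would therefore be caught.
    far⇒caught : (outer : Cube d → Bool) →
                 (∀ {x y} (p : y ⪯ x) → outer x ≡ false → outer y ≡ false → gap p ≤ w) →
                 ∀ ε → Far ε k f →
                 ∣ ↥ ε ∣ * 2 ^ d ≤ (count caught (allPoints d) + count outer (allPoints d)) * ↧ₙ ε
    far⇒caught outer narrow ε far = ≤-trans (far extension extension-kMonotone)
      (*-monoˡ-≤ (↧ₙ ε) (≤-trans (count-mono _ _ differ (allPoints d)) (count-∨ caught outer (allPoints d))))
      where
      D : Cube d → Set
      D x = outer x ≡ false × ¬ Caught x
      unreachable : ∀ x → ¬ Reach (λ y b → D y × f y ≡ b) (suc k) x
      unreachable x (y , _ , ((oy , ¬caught) , fy) , r) =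
        ¬caught (y , ⪯-refl , (∈-descend-refl w y , fy) , reach-map near k ⪯-refl r)
        where
        near : ∀ z b → z ⪯ y → D z × f z ≡ b → z ∈ descend w y × f z ≡ b
        near z b z⪯y ((oz , _) , fz) = ∈-descend w z⪯y (narrow z⪯y oy oz) , fz
      open Extension f D (λ x → outer x B.≟ false ×-dec ¬? (caught? x)) k unreachable
      differ : ∀ x → f x xor extension x ≡ true → caught x ∨ outer x ≡ true
      differ x neq with caught? x | outer x in eq
      ... | yes _ | _     = refl
      ... | no _  | true  = refl
      ... | no ¬c | false with () ← trans (sym neq)
        (trans (cong (_xor extension x) (extension-agrees (eq , ¬c))) (B.xor-same (extension x)))

-- Comparable middle points are close

-- The ratio of the bases is 1 + 1/s, whose s-th power is at least 2 by Bernoulli; this is used t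
-- times, and the remaining factors are at least 1.
ratio-^ : ∀ s t j .{{_ : NonZero s}} → s * t ≤ j → 2 ^ t * (2 * s) ^ j ≤ (2 + 2 * s) ^ j
ratio-^ s t j st≤j = begin
  2 ^ t * b ^ j                          ≡⟨ cong (2 ^ t *_) (split b) ⟩
  2 ^ t * ((b ^ s) ^ t * b ^ e)          ≡⟨ *-assoc (2 ^ t) _ _ ⟨
  2 ^ t * (b ^ s) ^ t * b ^ e            ≡⟨ cong (_* b ^ e) (^-distribʳ-* t 2 (b ^ s)) ⟨
  (2 * b ^ s) ^ t * b ^ e                ≤⟨ *-mono-≤ (^-monoˡ-≤ t double) (^-monoˡ-≤ e (m≤n+m b 2)) ⟩
  (a ^ s) ^ t * a ^ e                    ≡⟨ split a ⟨
  a ^ j                                  ∎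
  where
  open ≤-Reasoning
  b = 2 * s
  a = 2 + b
  e = j ∸ s * t
  split : ∀ c → c ^ j ≡ (c ^ s) ^ t * c ^ e
  split c = trans (cong (c ^_) (sym (m+[n∸m]≡n st≤j)))
    (trans (^-distribˡ-+-* c (s * t) e) (cong (_* c ^ e) (sym (^-*-assoc c s t))))
  double : 2 * b ^ s ≤ a ^ s
  double = *-cancelˡ-≤ b {{m*n≢0 2 s}} (begin
    b * (2 * b ^ s)      ≡⟨ eq s (b ^ s) ⟩
    b ^ s * (b + s * 2)  ≤⟨ bernoulli s b 2 ⟩
    b * (b + 2) ^ s      ≡⟨ cong (λ c → b * c ^ s) (+-comm b 2) ⟩
    b * a ^ s            ∎)
    where
    eq : ∀ s p → 2 * s * (2 * p) ≡ p * (2 * s + s * 2)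
    eq = solve-∀

-- A larger gap would make the product of the two weights at least `(a * b) ^ d * 2 ^ t`, while for
-- middle points it is below K² N^(2d). As N² = ab + 1 and 2d ≤ ab, passing from (ab)^d to N^(2d)
-- costs only a factor 2, which gives 2^t < 2K².
narrow-middle : ∀ s d K t .{{_ : NonZero s}} → d ≤ s * s → 2 * (K * K) ≤ 2 ^ t →
                let b = 2 * s ; a = 2 + b in
                {x y : Cube d} (p : y ⪯ x) →
                weight a b x < K * suc b ^ d → weight b a y < K * suc b ^ d → gap p ≤ s * t
narrow-middle s d K t d≤s² 2K²≤2^t {x} {y} p wx< wy< = ≮⇒≥ λ st<j → <-irrefl refl (begin-strict
  2 ^ t * (N * N) ^ d                 ≡⟨ cong (λ e → 2 ^ t * e ^ d) (n²≡1+ab s) ⟩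
  2 ^ t * suc (a * b) ^ d             ≤⟨ *-monoʳ-≤ (2 ^ t) (suc-^-≤-double (a * b) d 2d≤ab) ⟩
  2 ^ t * (2 * (a * b) ^ d)           ≡⟨ eq₁ (2 ^ t) ((a * b) ^ d) ⟩
  2 * ((a * b) ^ d * 2 ^ t)           ≤⟨ *-monoʳ-≤ 2 (heavy st<j) ⟩
  2 * (weight b a y * weight a b x)   <⟨ *-monoʳ-< 2 (*-mono-< wy< wx<) ⟩
  2 * (K * N ^ d * (K * N ^ d))       ≡⟨ eq₂ K (N ^ d) ⟩
  2 * (K * K) * (N ^ d * N ^ d)       ≤⟨ *-monoˡ-≤ (N ^ d * N ^ d) 2K²≤2^t ⟩
  2 ^ t * (N ^ d * N ^ d)             ≡⟨ cong (2 ^ t *_) (^-distribʳ-* d N N) ⟨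
  2 ^ t * (N * N) ^ d                 ∎)
  where
  open ≤-Reasoning
  b = 2 * s
  a = 2 + b
  N = suc b
  j = gap p
  instance
    b≢0 : NonZero b
    b≢0 = m*n≢0 2 s
    ab≢0 : NonZero (a * b)
    ab≢0 = m*n≢0 a b
  n²≡1+ab : ∀ s → suc (2 * s) * suc (2 * s) ≡ suc ((2 + 2 * s) * (2 * s))
  n²≡1+ab = solve-∀
  eq₁ : ∀ T P → T * (2 * P) ≡ 2 * (P * T)
  eq₁ = solve-∀
  eq₂ : ∀ K X → 2 * (K * X * (K * X)) ≡ 2 * (K * K) * (X * X)
  eq₂ = solve-∀
  2d≤ab : 2 * d ≤ a * b
  2d≤ab = begin
    2 * d                            ≤⟨ *-monoʳ-≤ 2 d≤s² ⟩
    2 * (s * s)                      ≤⟨ m≤m+n _ (4 * s + 2 * (s * s)) ⟩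
    2 * (s * s) + (4 * s + 2 * (s * s)) ≡⟨ eq₃ s ⟩
    a * b                            ∎
    where
    eq₃ : ∀ s → 2 * (s * s) + (4 * s + 2 * (s * s)) ≡ (2 + 2 * s) * (2 * s)
    eq₃ = solve-∀
  heavy : s * t < j → (a * b) ^ d * 2 ^ t ≤ weight b a y * weight a b x
  heavy st<j = *-cancelʳ-≤ _ _ (b ^ j) {{m^n≢0 b j}} (begin
    (a * b) ^ d * 2 ^ t * b ^ j             ≡⟨ *-assoc ((a * b) ^ d) _ _ ⟩
    (a * b) ^ d * (2 ^ t * b ^ j)           ≤⟨ *-monoʳ-≤ ((a * b) ^ d) (ratio-^ s t j (<⇒≤ st<j)) ⟩
    (a * b) ^ d * a ^ j                     ≡⟨ weight-gap a b p ⟨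
    weight b a y * weight a b x * b ^ j     ∎)

-- Choice of parameters and query complexity

↥-nonZero : ∀ ε → 0ℚ ℚ.< ε → NonZero ∣ ↥ ε ∣
↥-nonZero (ℚ.mkℚ (ℤ.+ suc _) _ _) _ = _
↥-nonZero (ℚ.mkℚ (ℤ.+ zero) _ _) 0<ε with () ← ℚ.positive 0<ε
↥-nonZero (ℚ.mkℚ (ℤ.-[1+ _ ]) _ _) 0<ε with () ← ℚ.positive 0<ε

query-bound : ∀ d s l r .{{_ : NonZero s}} → d ≤ 2 ^ l →
  2 ^ (2 + r) * suc d ^ (s * suc ((2 + r) + (2 + r))) ≤ 2 ^ (7 * (s * suc l * suc r))
query-bound d s l r d≤2^l = begin
  2 ^ (2 + r) * suc d ^ (s * t)             ≤⟨ *-monoʳ-≤ (2 ^ (2 + r)) (^-monoˡ-≤ (s * t) 1+d≤) ⟩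
  2 ^ (2 + r) * (2 ^ suc l) ^ (s * t)       ≡⟨ cong (2 ^ (2 + r) *_) (^-*-assoc 2 (suc l) (s * t)) ⟩
  2 ^ (2 + r) * 2 ^ (suc l * (s * t))       ≡⟨ ^-distribˡ-+-* 2 (2 + r) _ ⟨
  2 ^ (2 + r + suc l * (s * t))             ≤⟨ ^-monoʳ-≤ 2 exponents ⟩
  2 ^ (7 * (s * suc l * suc r))             ∎
  where
  open ≤-Reasoning
  t = suc ((2 + r) + (2 + r))
  1+d≤ : suc d ≤ 2 ^ suc l
  1+d≤ = begin
    1 + d                 ≤⟨ +-mono-≤ (m^n>0 2 l) d≤2^l ⟩
    2 ^ l + 2 ^ l         ≡⟨ cong (2 ^ l +_) (+-identityʳ (2 ^ l)) ⟨
    2 ^ suc l             ∎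
  -- With S = s (l + 1) and t = 2r + 5, the left side is at most S (3r + 7), hence at most 7 S (r +
  -- 1).
  exponents : 2 + r + suc l * (s * t) ≤ 7 * (s * suc l * suc r)
  exponents = begin
    2 + r + suc l * (s * t)                          ≤⟨ +-monoˡ-≤ (suc l * (s * t)) (m≤n*m (2 + r) (s * suc l) {{m*n≢0 s (suc l)}}) ⟩
    s * suc l * (2 + r) + suc l * (s * t)            ≤⟨ m≤m+n _ (4 * (s * suc l * r)) ⟩
    s * suc l * (2 + r) + suc l * (s * t) + 4 * (s * suc l * r) ≡⟨ eq s l r ⟩
    7 * (s * suc l * suc r)                          ∎
    where
    eq : ∀ s l r → s * suc l * (2 + r) + suc l * (s * suc ((2 + r) + (2 + r))) + 4 * (s * suc l * r)
                 ≡ 7 * (s * suc l * suc r)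
    eq = solve-∀

theorem1p2 : Σ ℕ λ C → (d k : ℕ) (ε : ℚ) → 0ℚ ℚ.< ε →
    Σ ℕ λ q → (q ≤ 2 ^ (C * exponent d ε)) × Σ (Tester d q) λ T → OneSidedKMonTester k ε T
theorem1p2 = 7 , construct
  where
  open ≤-Reasoning
  construct : ∀ d k ε → 0ℚ ℚ.< ε →
    Σ ℕ λ q → (q ≤ 2 ^ (7 * exponent d ε)) × Σ (Tester d q) λ T → OneSidedKMonTester k ε T
  -- For d = 0 the exponent is 0 and the bound allows one query, which reads f at the only point of
  -- the cube.
  construct zero k ε 0<ε = q , m^n>0 2 (7 * exponent 0 ε) , tester , complete , λ f far →
    sound f (subst (λ v → 3 * v ^ 1 ≤ (2 ^ 0) ^ 1) (sym (uncaught≡0 f far)) z≤n)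
    where
    open DescentTester 0 k 1 0
    uncaught≡0 : ∀ f → Far ε k f → count (not ∘ caught f) (allPoints 0) ≡ 0
    uncaught≡0 f far with count (caught f) (allPoints 0) | caught+uncaught f
                        | far⇒caught f (λ _ → false) (λ { [] _ _ → z≤n }) ε far
    ... | suc u | u+v≡1 | _   = m+n≡0⇒n≡0 u (suc-injective u+v≡1)
    ... | zero  | _     | h = contradiction h (<⇒≱ (*-mono-< {0} {∣ ↥ ε ∣} {0} {1} (>-nonZero⁻¹ _ {{↥-nonZero ε 0<ε}}) (s≤s z≤n)))
  construct d@(suc _) k ε 0<ε =
    q , query-bound d s ⌈log₂ d ⌉ r (n≤2^⌈log₂n⌉ d) , tester , complete , λ f far →
    sound f (subst (λ N → 3 * count (not ∘ caught f) (allPoints d) ^ K ≤ N ^ K)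
      (trans (+-comm _ (count (caught f) (allPoints d))) (caught+uncaught f))
      (triple-^-≤ K _ _ (subst (λ N → 2 * N ≤ K * count (caught f) (allPoints d))
         (sym (trans (+-comm _ (count (caught f) (allPoints d))) (caught+uncaught f)))
         (caught-many f far))))
    where
    s = ceilSqrt d
    r = ⌈log₂ invCeil ε ⌉
    M = 2 ^ r
    -- K = 4M is both the number of samples and the heaviness factor; M is at least 1/ε.
    K = 2 ^ (2 + r)
    -- Chosen so that 2^t = 2K², as `narrow-middle` requires.
    t = suc ((2 + r) + (2 + r))
    b = 2 * s
    a = 2 + b
    instance
      s≢0 : NonZero s
      s≢0 = ≢-nonZero λ s≡0 → n≮0 (subst (λ s → d ≤ s * s) s≡0 (≤-ceilSqrt² d))
      num≢0 : NonZero ∣ ↥ ε ∣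
      num≢0 = ↥-nonZero ε 0<ε
      K≢0 : NonZero K
      K≢0 = m^n≢0 2 (2 + r)
    open DescentTester d k K (s * t)

    high low outer : Cube d → Bool
    high x = K * suc b ^ d ≤ᵇ weight a b x
    low x = K * suc b ^ d ≤ᵇ weight b a x
    outer x = high x ∨ low x

    ≤ᵇ-false : ∀ m n → (m ≤ᵇ n) ≡ false → n < m
    ≤ᵇ-false m n eq = ≰⇒> λ m≤n → subst B.T eq (≤⇒≤ᵇ m≤n)

    narrow : ∀ {x y} (p : y ⪯ x) → outer x ≡ false → outer y ≡ false → gap p ≤ s * t
    narrow {x} {y} p ox oy = narrow-middle s d K t (≤-ceilSqrt² d)
      (≤-reflexive (cong (2 *_) (sym (^-distribˡ-+-* 2 (2 + r) (2 + r))))) p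
      (≤ᵇ-false _ _ (B.∨-conicalˡ (high x) (low x) ox))
      (≤ᵇ-false _ _ (B.∨-conicalʳ (high y) (low y) oy))

    den≤ : ↧ₙ ε ≤ M * ∣ ↥ ε ∣
    den≤ = ≤-trans (≤-ceilDiv-* (↧ₙ ε) ∣ ↥ ε ∣) (*-monoˡ-≤ ∣ ↥ ε ∣ (n≤2^⌈log₂n⌉ (invCeil ε)))

    -- Caught and outer points together have density at least 1/M = 4/K. The heavy points of either
    -- kind take up at most 1/K each, which leaves 2/K for caught points.
    caught-many : ∀ f → Far ε k f → 2 * 2 ^ d ≤ K * count (caught f) (allPoints d)
    caught-many f far = +-cancelʳ-≤ (2 * 2 ^ d) _ _ (begin
      2 * 2 ^ d + 2 * 2 ^ d              ≡⟨ eq₁ (2 ^ d) ⟩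
      4 * 2 ^ d                          ≤⟨ *-monoʳ-≤ 4 2^d≤ ⟩
      4 * ((u + o) * M)                  ≤⟨ *-monoʳ-≤ 4 (*-monoˡ-≤ M (+-monoʳ-≤ u (count-∨ high low (allPoints d)))) ⟩
      4 * ((u + (h + l)) * M)            ≡⟨ eq₂ u h l M ⟩
      K * u + (h * K + l * K)            ≤⟨ +-monoʳ-≤ (K * u) (+-mono-≤ (count-heavy d K (suc b) a b (eq₃ s)) (count-heavy d K (suc b) b a (eq₄ s))) ⟩
      K * u + (2 ^ d + 2 ^ d)            ≡⟨ cong (λ e → K * u + (2 ^ d + e)) (+-identityʳ (2 ^ d)) ⟨
      K * u + 2 * 2 ^ d                  ∎)
      where
      u = count (caught f) (allPoints d)
      o = count outer (allPoints d)
      h = count high (allPoints d)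
      l = count low (allPoints d)
      eq₁ : ∀ N → 2 * N + 2 * N ≡ 4 * N
      eq₁ = solve-∀
      eq₂ : ∀ u h l M → 4 * ((u + (h + l)) * M) ≡ 2 * (2 * M) * u + (h * (2 * (2 * M)) + l * (2 * (2 * M)))
      eq₂ = solve-∀
      eq₃ : ∀ s → 2 + 2 * s + 2 * s ≡ 2 * suc (2 * s)
      eq₃ = solve-∀
      eq₄ : ∀ s → 2 * s + (2 + 2 * s) ≡ 2 * suc (2 * s)
      eq₄ = solve-∀
      2^d≤ : 2 ^ d ≤ (u + o) * M
      2^d≤ = *-cancelˡ-≤ ∣ ↥ ε ∣ (begin
        ∣ ↥ ε ∣ * 2 ^ d                  ≤⟨ far⇒caught f outer narrow ε far ⟩
        (u + o) * ↧ₙ ε                   ≤⟨ *-monoʳ-≤ (u + o) den≤ ⟩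
        (u + o) * (M * ∣ ↥ ε ∣)          ≡⟨ *-assoc (u + o) M _ ⟨
        (u + o) * M * ∣ ↥ ε ∣            ≡⟨ *-comm ((u + o) * M) _ ⟩
        ∣ ↥ ε ∣ * ((u + o) * M)          ∎)
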